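{- If the IKJ algorithm is repeated two times (in succession on the same array $\mathtt{d}$, initialized by $\mathtt{d}[i,j]\leftarrow w(i,j)$ for all $i,j\in V$ before the first run only), it solves the all-pairs shortest path problem, i.e., afterwards $\mathtt{d}[i,j]$ stores the shortest path distance from $i$ to $j$ for all $i,j\in V$. Conversely, there exists an instance that needs two repeats of the IKJ algorithm to obtain a correct solution, i.e., an instance for which a single run does not give the shortest path distances for all pairs.
   Context: Let $G=(V,E)$ be a complete directed graph with vertex set $V=\{1,\dots,n\}$, and let $w\colon V\times V\to\mathbb{R}\cup\{\infty\}$ be the length of the edges. It is assumed that $G$ has no negative cycles. An instance consists of such a $G$ and $w$. The length of a path is the sum of the lengths of its edges, and the shortest path distance from one vertex to another is the length of a shortest path between them. The all-pairs shortest path problem asks for the shortest path distances for all $i,j\in V$. The IKJ algorithm works on an $n\times n$ array $\mathtt{d}$, initialized by $\mathtt{d}[i,j]\leftarrow w(i,j)$ for all $i,j\in V$. One run consists of the following triply nested loops, updating $\mathtt{d}$ in place: for $i=1,2,\dots,n$ (outermost), for $k=1,2,\dots,n$ (middle), for $j=1,2,\dots,n$ (innermost), perform $\mathtt{d}[i,j]\leftarrow\min\{\mathtt{d}[i,j],\ \mathtt{d}[i,k]+\mathtt{d}[k,j]\}$. -}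

module Defs where

open import Data.Fin.Base using (Fin)
open import Data.List.Base using (allFin; foldl)
open import Data.Nat.Base as ℕ using (ℕ)
import Data.Nat.Properties as ℕ
open import Data.Product using (∃; _×_; _,_)
open import Data.Rational
  using (ℚ; 0ℚ; ½; _+_; _*_; _-_; -_; _⊓_; ∣_∣; _≤_; _<_)
open import Data.Rational.Properties
import Data.Rational.Solver as ℚSolver
open import Data.Sum.Base using (inj₁; inj₂)
open import Data.Vec.Functional using (Vector; updateAt)
open import Function.Base using (const)
open import Relation.Binary.PropositionalEquality
  using (_≡_; refl; sym; trans; cong; subst; subst₂)
open import Relation.Nullary.Construct.Add.Supremum using (_⁺; [_]; ⊤⁺)
import Relation.Binary.Construct.Add.Supremum.Equality as SupremumEquality
import Relation.Binary.Construct.Add.Supremum.NonStrict as SupremumOrder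

IsCauchy : (ℕ → ℚ) → Set
IsCauchy x = ∀ ε → 0ℚ < ε →
  ∃ λ N → ∀ m n → N ℕ.≤ m → N ℕ.≤ n → ∣ x m - x n ∣ < ε

-- Real numbers are Cauchy sequences of rationals, with the setoid equality _≈_.
record ℝ : Set where
  constructor mkℝ
  field
    seq      : ℕ → ℚ
    isCauchy : IsCauchy seq

open ℝ public

infix 4 _≈_ _≤ℝ_

_≈_ : ℝ → ℝ → Set
x ≈ y = ∀ ε → 0ℚ < ε → ∃ λ N → ∀ n → N ℕ.≤ n → ∣ seq x n - seq y n ∣ < ε

_≤ℝ_ : ℝ → ℝ → Set
x ≤ℝ y = ∀ ε → 0ℚ < ε → ∃ λ N → ∀ n → N ℕ.≤ n → seq x n < seq y n + ε

private
  ½*-pos : ∀ {ε} → 0ℚ < ε → 0ℚ < ½ * ε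
  ½*-pos {ε} 0<ε = subst (_< ½ * ε) (*-zeroʳ ½) (*-monoʳ-<-pos ½ 0<ε)

  ½+½ : ∀ ε → ½ * ε + ½ * ε ≡ ε
  ½+½ ε = trans (sym (*-distribʳ-+ ε ½ ½)) (*-identityˡ ε)

  open ℚSolver.+-*-Solver using (solve; _:=_; :-_; _:-_; _:+_)

  -[p-q]≡q-p : ∀ p q → - (p - q) ≡ q - p
  -[p-q]≡q-p = solve 2 (λ p q → :- (p :- q) := q :- p) refl

  ∣p-q∣-sym : ∀ p q → ∣ p - q ∣ ≡ ∣ q - p ∣
  ∣p-q∣-sym p q = trans (sym (∣-p∣≡∣p∣ (p - q))) (cong ∣_∣ (-[p-q]≡q-p p q))

  -‿below : ∀ {ε} p q → ∣ p - q ∣ < ε → p - q < ε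
  -‿below p q h = ≤-<-trans (p≤∣p∣ (p - q)) h
    where
    p≤∣p∣ : ∀ p → p ≤ ∣ p ∣
    p≤∣p∣ p with ≤-total 0ℚ p
    ... | inj₁ 0≤p = ≤-reflexive (sym (0≤p⇒∣p∣≡p 0≤p))
    ... | inj₂ p≤0 = ≤-trans p≤0 (0≤∣p∣ p)

  ∣-∣-below : ∀ {ε} p q → p - q < ε → q - p < ε → ∣ p - q ∣ < ε
  ∣-∣-below {ε} p q h k with ∣p∣≡p∨∣p∣≡-p (p - q)
  ... | inj₁ eq = subst (_< ε) (sym eq) h
  ... | inj₂ eq = subst (_< ε) (sym (trans eq (-[p-q]≡q-p p q))) k

  +-close : ∀ {ε} p q r s → ∣ p - r ∣ < ½ * ε → ∣ q - s ∣ < ½ * ε →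
            ∣ (p + q) - (r + s) ∣ < ε
  +-close {ε} p q r s h k =
    subst₂ (λ a b → ∣ a ∣ < b) (rearrange p q r s) (½+½ ε)
      (≤-<-trans (∣p+q∣≤∣p∣+∣q∣ (p - r) (q - s)) (+-mono-< h k))
    where
    rearrange : ∀ p q r s → (p - r) + (q - s) ≡ (p + q) - (r + s)
    rearrange = solve 4 (λ p q r s →
      (p :- r) :+ (q :- s) := (p :+ q) :- (r :+ s)) refl

  ⊓-below : ∀ {ε} p q r s → p - r < ε → q - s < ε → (p ⊓ q) - (r ⊓ s) < ε
  ⊓-below {ε} p q r s h k with ≤-total r s
  ... | inj₁ r≤s = subst (λ t → (p ⊓ q) - t < ε) (sym (p≤q⇒p⊓q≡p r≤s))
                     (≤-<-trans (+-monoˡ-≤ (- r) (p⊓q≤p p q)) h)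
  ... | inj₂ s≤r = subst (λ t → (p ⊓ q) - t < ε) (sym (p≥q⇒p⊓q≡q s≤r))
                     (≤-<-trans (+-monoˡ-≤ (- s) (p⊓q≤q p q)) k)

  ⊓-close : ∀ {ε} p q r s → ∣ p - r ∣ < ε → ∣ q - s ∣ < ε →
            ∣ (p ⊓ q) - (r ⊓ s) ∣ < ε
  ⊓-close {ε} p q r s h k = ∣-∣-below (p ⊓ q) (r ⊓ s)
    (⊓-below p q r s (-‿below p r h) (-‿below q s k))
    (⊓-below r s p q (-‿below r p (subst (_< ε) (∣p-q∣-sym p r) h))
                     (-‿below s q (subst (_< ε) (∣p-q∣-sym q s) k)))

0ℝ : ℝ
0ℝ = mkℝ (const 0ℚ) λ ε 0<ε → 0 , λ _ _ _ _ → 0<ε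

infixl 6 _+ℝ_
infixl 7 _⊓ℝ_

_+ℝ_ : ℝ → ℝ → ℝ
seq (x +ℝ y) n = seq x n + seq y n
isCauchy (x +ℝ y) ε 0<ε
  with M , p ← isCauchy x (½ * ε) (½*-pos 0<ε)
     | N , q ← isCauchy y (½ * ε) (½*-pos 0<ε)
  = M ℕ.⊔ N , λ m n m≥ n≥ → +-close (seq x m) (seq y m) (seq x n) (seq y n)
      (p m n (ℕ.m⊔n≤o⇒m≤o M N m≥) (ℕ.m⊔n≤o⇒m≤o M N n≥))
      (q m n (ℕ.m⊔n≤o⇒n≤o M N m≥) (ℕ.m⊔n≤o⇒n≤o M N n≥))

_⊓ℝ_ : ℝ → ℝ → ℝ
seq (x ⊓ℝ y) n = seq x n ⊓ seq y n
isCauchy (x ⊓ℝ y) ε 0<ε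
  with M , p ← isCauchy x ε 0<ε
     | N , q ← isCauchy y ε 0<ε
  = M ℕ.⊔ N , λ m n m≥ n≥ → ⊓-close (seq x m) (seq y m) (seq x n) (seq y n)
      (p m n (ℕ.m⊔n≤o⇒m≤o M N m≥) (ℕ.m⊔n≤o⇒m≤o M N n≥))
      (q m n (ℕ.m⊔n≤o⇒n≤o M N m≥) (ℕ.m⊔n≤o⇒n≤o M N n≥))

-- ℝ ∪ {∞}, with ⊤⁺ as ∞.
ℝ∞ : Set
ℝ∞ = ℝ ⁺

open SupremumEquality _≈_ public using (_≈⁺_)
open SupremumOrder _≤ℝ_ public using (_≤⁺_)

infixl 6 _+∞_
infixl 7 _⊓∞_

_+∞_ : ℝ∞ → ℝ∞ → ℝ∞
[ x ] +∞ [ y ] = [ x +ℝ y ]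
[ _ ] +∞ ⊤⁺    = ⊤⁺
⊤⁺    +∞ _     = ⊤⁺

_⊓∞_ : ℝ∞ → ℝ∞ → ℝ∞
[ x ] ⊓∞ [ y ] = [ x ⊓ℝ y ]
[ x ] ⊓∞ ⊤⁺    = [ x ]
⊤⁺    ⊓∞ y     = y

Array : ℕ → Set
Array n = Vector (Vector ℝ∞ n) n

-- Paths of the complete digraph on Fin n, loops included. They may repeat
-- vertices and have at least one edge, since w(i,i) is not assumed to be 0:
-- with n = 1 and w(1,1) > 0 the algorithm never stores 0. If w(i,i) = 0 and
-- there are no negative cycles, the empty path would not change any distance.
infixr 5 _∷_

data Path {n : ℕ} : Fin n → Fin n → Set where
  edge : ∀ i j → Path i j
  _∷_  : ∀ i {j k} → Path j k → Path i k

pathLength : ∀ {n} → Array n → {i j : Fin n} → Path i j → ℝ∞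
pathLength w (edge i j)    = w i j
pathLength w (_∷_ i {j} p) = w i j +∞ pathLength w p

NoNegativeCycles : ∀ {n} → Array n → Set
NoNegativeCycles w = ∀ i (c : Path i i) → [ 0ℝ ] ≤⁺ pathLength w c

record Instance : Set where
  field
    n                : ℕ
    w                : Array n
    noNegativeCycles : NoNegativeCycles w

IsShortestPath : ∀ {n} → Array n → {i j : Fin n} → Path i j → Set
IsShortestPath w {i} {j} p = ∀ (q : Path i j) → pathLength w p ≤⁺ pathLength w q

-- Selecting a shortest path means comparing real path lengths, so that the
-- existence of one rests on excluded middle.
IsShortestPathDistance : ∀ {n} → Array n → Fin n → Fin n → ℝ∞ → Set
IsShortestPathDistance w i j x =
  ∃ λ (p : Path i j) → IsShortestPath w p × x ≈⁺ pathLength w p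

SolvesAPSP : (I : Instance) → Array (Instance.n I) → Set
SolvesAPSP I d = ∀ i j → IsShortestPathDistance (Instance.w I) i j (d i j)

for : ∀ {n} {S : Set} → (Fin n → S → S) → S → S
for {n} body s = foldl (λ s i → body i s) s (allFin n)

_[_,_]≔_ : ∀ {n} → Array n → Fin n → Fin n → ℝ∞ → Array n
d [ i , j ]≔ x = updateAt d i λ row → updateAt row j (const x)

relax : ∀ {n} → Fin n → Fin n → Fin n → Array n → Array n
relax i k j d = d [ i , j ]≔ (d i j ⊓∞ (d i k +∞ d k j))

ikj : ∀ {n} → Array n → Array n
ikj = for λ i → for λ k → for λ j → relax i k j

{-# OPTIONS --safe #-}
module Submission where

-- The pass over row i is a Floyd–Warshall induction on the middle index k. If,
-- for every k < m, row k is at most the length of all paths out of k whose inner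
-- vertices are below k, then after the pass row i is at most the length of all
-- paths out of i whose inner vertices are below m: such a path either avoids
-- m - 1 or, after dropping a cycle through m - 1, splits there in two.
-- In the first run the rows above row i have been treated, so m = i is
-- available; in the second run all rows satisfy the hypothesis, so m = n is
-- available, which means all paths.
-- One run fails on 0 → 2 → 1 → 3: row 0 reaches 1 through 2 only after the
-- middle index has passed 1.

open import Defs
open import Axiom.ExcludedMiddle using (ExcludedMiddle)
open import Data.Bool.Base using (Bool; true; false; if_then_else_)
open import Data.Empty using (⊥-elim)
open import Data.Fin.Base using (Fin; zero; suc; toℕ)
open import Data.Fin.Patterns using (0F; 1F; 2F; 3F)
import Data.Fin.Properties as Fin
open import Data.List.Base using (foldl; tabulate)
open import Data.Nat.Base as ℕ using (ℕ; zero; suc; z≤n)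
import Data.Nat.Properties as ℕ
open import Data.Product using (∃; _×_; _,_; proj₁; proj₂)
open import Data.Rational using (ℚ; 0ℚ; ½; _+_; _*_; _-_; -_; _⊓_; ∣_∣; _≤_; _<_)
open import Data.Rational.Properties
import Data.Rational.Solver as ℚSolver
open import Data.Sum.Base using (_⊎_; inj₁; inj₂; [_,_]′)
open import Data.Unit.Base using (⊤; tt)
open import Data.Vec.Functional.Properties using (updateAt-updates; updateAt-minimal)
open import Function.Base using (_∘_; const; id)
open import Level using (0ℓ)
open import Relation.Binary.Bundles using (Preorder)
open import Relation.Binary.Definitions using (Reflexive; Transitive; Antisymmetric; Total)
import Relation.Binary.Construct.Add.Supremum.NonStrict as SupremumOrder
open import Relation.Binary.PropositionalEquality
  using (_≡_; refl; sym; trans; cong; subst; isEquivalence)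
import Relation.Binary.Reasoning.Preorder as PreorderReasoning
open import Relation.Nullary using (Dec; yes; no; does; ¬_)
open import Relation.Nullary.Construct.Add.Supremum using ([_]; ⊤⁺)

open SupremumOrder _≤ℝ_
  using ([_]; _≤⊤⁺; ≤⁺-total; ≤⁺-antisym; ≤⁺-isPreorder-≡)

-- The order on ℝ ∪ {∞}

halve : ∀ {ε} → 0ℚ < ε → ∃ λ δ → 0ℚ < δ × δ + δ ≡ ε
halve {ε} 0<ε =
  ½ * ε ,
  subst (_< ½ * ε) (*-zeroʳ ½) (*-monoʳ-<-pos ½ 0<ε) ,
  trans (sym (*-distribʳ-+ ε ½ ½)) (*-identityˡ ε)

p<p+ε : ∀ {ε} p → 0ℚ < ε → p < p + ε
p<p+ε {ε} p 0<ε = subst (_< p + ε) (+-identityʳ p) (+-monoʳ-< p 0<ε)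

p≤∣p∣ : ∀ p → p ≤ ∣ p ∣
p≤∣p∣ p with ≤-total 0ℚ p
... | inj₁ 0≤p = ≤-reflexive (sym (0≤p⇒∣p∣≡p 0≤p))
... | inj₂ p≤0 = ≤-trans p≤0 (0≤∣p∣ p)

module _ where
  open ℚSolver.+-*-Solver using (solve; _:=_; :-_; _:-_; _:+_)

  ∣p-q∣<ε⇒p<q+ε : ∀ {ε} p q → ∣ p - q ∣ < ε → p < q + ε
  ∣p-q∣<ε⇒p<q+ε {ε} p q h =
    subst (_< q + ε) (solve 2 (λ p q → q :+ (p :- q) := p) refl p q)
      (+-monoʳ-< q (≤-<-trans (p≤∣p∣ (p - q)) h))

  p<q+ε⇒p-q<ε : ∀ {ε} p q → p < q + ε → p - q < ε
  p<q+ε⇒p-q<ε {ε} p q h =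
    subst (p - q <_) (solve 2 (λ q ε → (q :+ ε) :- q := ε) refl q ε) (+-monoˡ-< (- q) h)

  ∣p-q∣<ε : ∀ {ε} p q → p < q + ε → q < p + ε → ∣ p - q ∣ < ε
  ∣p-q∣<ε {ε} p q h k with ∣p∣≡p∨∣p∣≡-p (p - q)
  ... | inj₁ eq = subst (_< ε) (sym eq) (p<q+ε⇒p-q<ε p q h)
  ... | inj₂ eq =
    subst (_< ε) (sym (trans eq (solve 2 (λ p q → :- (p :- q) := q :- p) refl p q)))
      (p<q+ε⇒p-q<ε q p k)

  +-interchange : ∀ p q r s → (p + q) + (r + s) ≡ (p + r) + (q + s)
  +-interchange = solve 4 (λ p q r s → (p :+ q) :+ (r :+ s) := (p :+ r) :+ (q :+ s)) refl

Eventually : (ℕ → Set) → Set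
Eventually P = ∃ λ N → ∀ n → N ℕ.≤ n → P n

eventually-map₂ : ∀ {P Q R : ℕ → Set} → (∀ n → P n → Q n → R n) →
                  Eventually P → Eventually Q → Eventually R
eventually-map₂ f (M , p) (N , q) =
  M ℕ.⊔ N , λ n h → f n (p n (ℕ.m⊔n≤o⇒m≤o M N h)) (q n (ℕ.m⊔n≤o⇒n≤o M N h))

pointwise⇒≤ℝ : ∀ {x y} → (∀ n → seq x n ≤ seq y n) → x ≤ℝ y
pointwise⇒≤ℝ {y = y} h ε 0<ε = 0 , λ n _ → ≤-<-trans (h n) (p<p+ε (seq y n) 0<ε)

≤ℝ-refl : Reflexive _≤ℝ_
≤ℝ-refl {x} = pointwise⇒≤ℝ {x} {x} λ _ → ≤-refl

≤ℝ-trans : Transitive _≤ℝ_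
≤ℝ-trans {x} {y} {z} x≤y y≤z ε 0<ε with δ , 0<δ , refl ← halve 0<ε =
  eventually-map₂
    (λ n p q → subst (seq x n <_) (+-assoc (seq z n) δ δ)
                 (<-trans p (+-monoˡ-< δ q)))
    (x≤y δ 0<δ) (y≤z δ 0<δ)

≤ℝ-antisym : Antisymmetric _≈_ _≤ℝ_
≤ℝ-antisym {x} {y} x≤y y≤x ε 0<ε =
  eventually-map₂ (λ n → ∣p-q∣<ε (seq x n) (seq y n)) (x≤y ε 0<ε) (y≤x ε 0<ε)

+ℝ-mono-≤ : ∀ {x y u v} → x ≤ℝ y → u ≤ℝ v → x +ℝ u ≤ℝ y +ℝ v
+ℝ-mono-≤ {x} {y} {u} {v} x≤y u≤v ε 0<ε with δ , 0<δ , refl ← halve 0<ε =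
  eventually-map₂
    (λ n p q → subst (seq x n + seq u n <_) (+-interchange (seq y n) δ (seq v n) δ)
                 (+-mono-< p q))
    (x≤y δ 0<δ) (u≤v δ 0<δ)

⊓ℝ-glb : ∀ {x y z} → z ≤ℝ x → z ≤ℝ y → z ≤ℝ x ⊓ℝ y
⊓ℝ-glb {x} {y} {z} z≤x z≤y ε 0<ε = eventually-map₂ both (z≤x ε 0<ε) (z≤y ε 0<ε)
  where
  both : ∀ n → seq z n < seq x n + ε → seq z n < seq y n + ε → seq z n < (seq x n ⊓ seq y n) + ε
  both n p q with ⊓-sel (seq x n) (seq y n)
  ... | inj₁ eq = subst (λ t → seq z n < t + ε) (sym eq) p
  ... | inj₂ eq = subst (λ t → seq z n < t + ε) (sym eq) q

Settled : ℝ → ℚ → Set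
Settled x ε = ∃ λ N → ∀ m n → N ℕ.≤ m → N ℕ.≤ n → seq x m < seq x n + ε

settles : ∀ x ε → 0ℚ < ε → Settled x ε
settles x ε 0<ε with N , c ← isCauchy x ε 0<ε =
  N , λ m n N≤m N≤n → ∣p-q∣<ε⇒p<q+ε (seq x m) (seq x n) (c m n N≤m N≤n)

-- If p and q approximate p′ and q′ up to δ, comparing p′ with q′ + 2δ decides
-- between p < q + 4δ and q < p.
approx-< : ∀ {δ p p′ q q′} → p < p′ + δ → q′ < q + δ → p′ < q′ + (δ + δ) →
           p < q + ((δ + δ) + (δ + δ))
approx-< {δ} {p} {p′} {q} {q′} p<p′ q′<q h = begin-strict
  p                            <⟨ p<p′ ⟩
  p′ + δ                       <⟨ +-monoˡ-< δ h ⟩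
  (q′ + (δ + δ)) + δ           <⟨ +-monoˡ-< δ (+-monoˡ-< (δ + δ) q′<q) ⟩
  ((q + δ) + (δ + δ)) + δ      ≡⟨ regroup q δ ⟩
  q + ((δ + δ) + (δ + δ))      ∎
  where
  open ≤-Reasoning
  open ℚSolver.+-*-Solver using (solve; _:=_; _:+_)
  regroup : ∀ p q → ((p + q) + (q + q)) + q ≡ p + ((q + q) + (q + q))
  regroup = solve 2 (λ p q → ((p :+ q) :+ (q :+ q)) :+ q := p :+ ((q :+ q) :+ (q :+ q))) refl

approx-≮ : ∀ {δ p p′ q q′} → p′ < p + δ → q < q′ + δ → ¬ (p′ < q′ + (δ + δ)) → q < p
approx-≮ {δ} {p} {p′} {q} {q′} p′<p q<q′ h = ≰⇒> λ p≤q → h (begin-strict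
  p′                <⟨ p′<p ⟩
  p + δ             ≤⟨ +-monoˡ-≤ δ p≤q ⟩
  q + δ             <⟨ +-monoˡ-< δ q<q′ ⟩
  (q′ + δ) + δ      ≡⟨ +-assoc q′ δ δ ⟩
  q′ + (δ + δ)      ∎)
  where open ≤-Reasoning

-- A constructive stand-in for totality: one decidable comparison of rational approximations at a
-- late index settles it, at the price of the tolerance `ε` on one side. Of four quarters of `ε`,
-- one goes to each approximation and two to the threshold.
≤ℝ-cotrans : ∀ x y ε → 0ℚ < ε →
  Eventually (λ n → seq x n < seq y n + ε) ⊎ Eventually (λ n → seq y n < seq x n)
≤ℝ-cotrans x y ε 0<ε =
  let η , 0<η , η+η≡ε = halve 0<ε
      δ , 0<δ , δ+δ≡η = halve 0<η
  in subst (λ ε → Eventually (λ n → seq x n < seq y n + ε) ⊎ Eventually (λ n → seq y n < seq x n))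
       (trans (cong (λ η → η + η) δ+δ≡η) η+η≡ε)
       (decide δ (settles x δ 0<δ) (settles y δ 0<δ))
  where
  decide : ∀ δ → Settled x δ → Settled y δ →
    Eventually (λ n → seq x n < seq y n + ((δ + δ) + (δ + δ))) ⊎
    Eventually (λ n → seq y n < seq x n)
  decide δ (M , sx) (N , sy) = go (seq x K <? seq y K + (δ + δ))
    where
    K : ℕ
    K = M ℕ.⊔ N

    go : Dec (seq x K < seq y K + (δ + δ)) →
      Eventually (λ n → seq x n < seq y n + ((δ + δ) + (δ + δ))) ⊎
      Eventually (λ n → seq y n < seq x n)
    go (yes h) = inj₁ (K , λ n K≤n →
      approx-< {q = seq y n} {q′ = seq y K} (sx n K (ℕ.m⊔n≤o⇒m≤o M N K≤n) (ℕ.m≤m⊔n M N))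
               (sy K n (ℕ.m≤n⊔m M N) (ℕ.m⊔n≤o⇒n≤o M N K≤n)) h)
    go (no h) = inj₂ (K , λ n K≤n →
      approx-≮ {p = seq x n} {q′ = seq y K} (sx K n (ℕ.m≤m⊔n M N) (ℕ.m⊔n≤o⇒m≤o M N K≤n))
               (sy n K (ℕ.m⊔n≤o⇒n≤o M N K≤n) (ℕ.m≤n⊔m M N)) h)

-- Excluded middle is asked only for an eventual strict inequality. If that fails, the second
-- alternative of `≤ℝ-cotrans` is ruled out for every `ε`, leaving the first.
≤ℝ-total : ExcludedMiddle 0ℓ → Total _≤ℝ_
≤ℝ-total em x y with em {Eventually (λ n → seq y n < seq x n)}
... | yes (N , h) = inj₂ λ ε 0<ε → N , λ n N≤n →
        <-trans (h n N≤n) (p<p+ε (seq x n) 0<ε)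
... | no ¬h = inj₁ λ ε 0<ε → [ id , ⊥-elim ∘ ¬h ]′ (≤ℝ-cotrans x y ε 0<ε)

≤-preorder : Preorder 0ℓ 0ℓ 0ℓ
≤-preorder = record
  { _≲_ = _≤⁺_
  ; isPreorder = ≤⁺-isPreorder-≡ record
      { isEquivalence = isEquivalence
      ; reflexive     = λ { {x} refl → ≤ℝ-refl {x} }
      ; trans         = λ {x} {y} {z} → ≤ℝ-trans {x} {y} {z}
      }
  }

open Preorder ≤-preorder using () renaming (refl to ≤∞-refl; trans to ≤∞-trans)

+∞-mono-≤ : ∀ {x y u v} → x ≤⁺ y → u ≤⁺ v → x +∞ u ≤⁺ y +∞ v
+∞-mono-≤ ([_] {x} {y} p) ([_] {u} {v} q) = [ +ℝ-mono-≤ {x} {y} {u} {v} p q ]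
+∞-mono-≤ [ _ ]           (_ ≤⊤⁺)         = _ ≤⊤⁺
+∞-mono-≤ (_ ≤⊤⁺)         _               = _ ≤⊤⁺

-- Associativity comes as two inequalities because `≡` on reals would also compare the Cauchy
-- proofs.
+∞-assoc-≤ : ∀ x y z → x +∞ (y +∞ z) ≤⁺ (x +∞ y) +∞ z
+∞-assoc-≤ [ x ] [ y ] [ z ] =
  [ pointwise⇒≤ℝ {x +ℝ (y +ℝ z)} {x +ℝ y +ℝ z}
      (λ n → ≤-reflexive (sym (+-assoc (seq x n) (seq y n) (seq z n)))) ]
+∞-assoc-≤ [ _ ] [ _ ] ⊤⁺    = _ ≤⊤⁺
+∞-assoc-≤ [ _ ] ⊤⁺    _     = _ ≤⊤⁺
+∞-assoc-≤ ⊤⁺    _     _     = _ ≤⊤⁺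

+∞-assoc-≥ : ∀ x y z → (x +∞ y) +∞ z ≤⁺ x +∞ (y +∞ z)
+∞-assoc-≥ [ x ] [ y ] [ z ] =
  [ pointwise⇒≤ℝ {x +ℝ y +ℝ z} {x +ℝ (y +ℝ z)}
      (λ n → ≤-reflexive (+-assoc (seq x n) (seq y n) (seq z n))) ]
+∞-assoc-≥ [ _ ] [ _ ] ⊤⁺    = _ ≤⊤⁺
+∞-assoc-≥ [ _ ] ⊤⁺    _     = _ ≤⊤⁺
+∞-assoc-≥ ⊤⁺    _     _     = _ ≤⊤⁺

+∞-identityˡ-≥ : ∀ x → x ≤⁺ [ 0ℝ ] +∞ x
+∞-identityˡ-≥ [ x ] =
  [ pointwise⇒≤ℝ {x} {0ℝ +ℝ x} (λ n → ≤-reflexive (sym (+-identityˡ (seq x n)))) ]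
+∞-identityˡ-≥ ⊤⁺    = _ ≤⊤⁺

x⊓∞y≤x : ∀ x y → x ⊓∞ y ≤⁺ x
x⊓∞y≤x [ x ] [ y ] = [ pointwise⇒≤ℝ {x ⊓ℝ y} {x} (λ n → p⊓q≤p (seq x n) (seq y n)) ]
x⊓∞y≤x [ x ] ⊤⁺    = ≤∞-refl
x⊓∞y≤x ⊤⁺    _     = _ ≤⊤⁺

x⊓∞y≤y : ∀ x y → x ⊓∞ y ≤⁺ y
x⊓∞y≤y [ x ] [ y ] = [ pointwise⇒≤ℝ {x ⊓ℝ y} {y} (λ n → p⊓q≤q (seq x n) (seq y n)) ]
x⊓∞y≤y [ _ ] ⊤⁺    = _ ≤⊤⁺
x⊓∞y≤y ⊤⁺    _     = ≤∞-refl

⊓∞-glb : ∀ {x y z} → z ≤⁺ x → z ≤⁺ y → z ≤⁺ x ⊓∞ y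
⊓∞-glb ([_] {z} {x} p) ([_] {_} {y} q) = [ ⊓ℝ-glb {x} {y} {z} p q ]
⊓∞-glb [ p ]           (_ ≤⊤⁺)         = [ p ]
⊓∞-glb (_ ≤⊤⁺)         q               = q

-- The minimum of reals is taken index by index and may switch between the two sequences forever, so
-- selecting an argument rests on totality. This is the only way excluded middle enters the proof.
⊓∞-sel-≤ : ExcludedMiddle 0ℓ → ∀ x y → x ≤⁺ x ⊓∞ y ⊎ y ≤⁺ x ⊓∞ y
⊓∞-sel-≤ em x y with ≤⁺-total (≤ℝ-total em) x y
... | inj₁ x≤y = inj₁ (⊓∞-glb ≤∞-refl x≤y)
... | inj₂ y≤x = inj₂ (⊓∞-glb y≤x ≤∞-refl)

-- Loop invariants

for-induction : ∀ {n} {S : Set} {body : Fin n → S → S} (P : ℕ → S → Set) →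
                (∀ i s → P (toℕ i) s → P (suc (toℕ i)) (body i s)) →
                ∀ s → P 0 s → P n (for body s)
for-induction {n} {S} {body} P step s p₀ =
  subst (λ m → P m (for body s)) (ℕ.+-identityʳ n)
    (go id 0 (λ i → sym (ℕ.+-identityʳ (toℕ i))) s p₀)
  where
  -- `allFin n` is `tabulate id`, whose tail tabulates a shifted function. Hence a general `g` with
  -- shift `k`, the number of iterations already done.
  go : ∀ {m} (g : Fin m → Fin n) k → (∀ i → toℕ (g i) ≡ toℕ i ℕ.+ k) →
       ∀ s → P k s → P (m ℕ.+ k) (foldl (λ s i → body i s) s (tabulate g))
  go {zero}  g k g≡ s p = p
  go {suc m} g k g≡ s p =
    subst (λ l → P l (foldl (λ s i → body i s) (body (g zero) s) (tabulate (g ∘ suc)))) (ℕ.+-suc m k)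
      (go (g ∘ suc) (suc k) (λ i → trans (g≡ (suc i)) (sym (ℕ.+-suc (toℕ i) k))) _
        (subst (λ l → P (suc l) (body (g zero) s)) (g≡ zero)
          (step (g zero) s (subst (λ l → P l s) (sym (g≡ zero)) p))))

for-preserves : ∀ {n} {S : Set} {body : Fin n → S → S} (P : S → Set) →
                (∀ i s → P s → P (body i s)) → ∀ s → P s → P (for body s)
for-preserves P = for-induction (const P)

-- The pointwise order on arrays and the effect of one sweep.

module _ {n : ℕ} where

  infix 4 _⊑_

  _⊑_ : Array n → Array n → Set
  d ⊑ e = ∀ i j → d i j ≤⁺ e i j

  ⊑-refl : ∀ {d} → d ⊑ d
  ⊑-refl i j = ≤∞-refl

  ⊑-trans : ∀ {d e f} → d ⊑ e → e ⊑ f → d ⊑ f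
  ⊑-trans p q i j = ≤∞-trans (p i j) (q i j)

  ≔-same : ∀ (d : Array n) i j x → (d [ i , j ]≔ x) i j ≡ x
  ≔-same d i j x =
    trans (cong (λ row → row j) (updateAt-updates i d))
          (updateAt-updates j (d i))

  -- `P` depends on the cell so that it can speak of paths from `a` to `b`.
  ≔-elim : ∀ (P : Fin n → Fin n → ℝ∞ → Set) (d : Array n) i j x →
           P i j x → (∀ a b → P a b (d a b)) → ∀ a b → P a b ((d [ i , j ]≔ x) a b)
  ≔-elim P d i j x new old a b with a Fin.≟ i
  ... | no a≢i = subst (P a b) (sym (cong (λ row → row b) (updateAt-minimal a i d a≢i))) (old a b)
  ... | yes refl with b Fin.≟ j
  ...   | yes refl = subst (P a b) (sym (≔-same d a b x)) new
  ...   | no b≢j   = subst (P a b)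
            (sym (trans (cong (λ row → row b) (updateAt-updates a d))
                        (updateAt-minimal b j (d a) b≢j)))
            (old a b)

  relax-⊑ : ∀ i k j d → relax i k j d ⊑ d
  relax-⊑ i k j d = ≔-elim (λ a b x → x ≤⁺ d a b) d i j _ (x⊓∞y≤x _ _) (λ _ _ → ≤∞-refl)

  relax-≤ : ∀ i k j d → relax i k j d i j ≤⁺ d i k +∞ d k j
  relax-≤ i k j d =
    subst (_≤⁺ d i k +∞ d k j) (sym (≔-same d i j _)) (x⊓∞y≤y (d i j) _)

  for-⊑ : ∀ {m} {body : Fin m → Array n → Array n} →
          (∀ i d → body i d ⊑ d) → ∀ d → for body d ⊑ d
  for-⊑ h d = for-preserves (_⊑ d) (λ i e e⊑d → ⊑-trans (h i e) e⊑d) d ⊑-refl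

  relaxAll : Fin n → Fin n → Array n → Array n
  relaxAll i k = for λ j → relax i k j

  processRow : Fin n → Array n → Array n
  processRow i = for λ k → relaxAll i k

  relaxAll-⊑ : ∀ i k d → relaxAll i k d ⊑ d
  relaxAll-⊑ i k = for-⊑ (relax-⊑ i k)

  processRow-⊑ : ∀ i d → processRow i d ⊑ d
  processRow-⊑ i = for-⊑ (relaxAll-⊑ i)

  ikj-⊑ : ∀ d → ikj d ⊑ d
  ikj-⊑ = for-⊑ processRow-⊑

  -- The sweep runs in place and may change `d i k`, and all of row `k` when `k` is `i`. Entries
  -- only decrease, so the old values still bound from above whatever is read.
  relaxAll-≤ : ∀ i k d j → relaxAll i k d i j ≤⁺ d i k +∞ d k j
  relaxAll-≤ i k d j = proj₂ (for-induction P step d (⊑-refl , λ _ ())) j (Fin.toℕ<n j)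
    where
    P : ℕ → Array n → Set
    P m e = e ⊑ d × ∀ j → toℕ j ℕ.< m → e i j ≤⁺ d i k +∞ d k j

    step : ∀ j e → P (toℕ j) e → P (suc (toℕ j)) (relax i k j e)
    step j e (e⊑d , h) = ⊑-trans (relax-⊑ i k j e) e⊑d , row
      where
      row : ∀ b → toℕ b ℕ.< suc (toℕ j) → relax i k j e i b ≤⁺ d i k +∞ d k b
      row b b<1+j with ℕ.m<1+n⇒m<n∨m≡n b<1+j
      ... | inj₁ b<j = ≤∞-trans (relax-⊑ i k j e i b) (h b b<j)
      ... | inj₂ b≡j with refl ← Fin.toℕ-injective b≡j =
        ≤∞-trans (relax-≤ i k j e) (+∞-mono-≤ (e⊑d i k) (e⊑d k j))

-- Paths with restricted inner vertices

module _ {n : ℕ} (w : Array n) where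

  open PreorderReasoning ≤-preorder

  infixr 5 _++_

  _++_ : ∀ {i j k : Fin n} → Path i j → Path j k → Path i k
  edge i j ++ q = i ∷ q
  (i ∷ p)  ++ q = i ∷ (p ++ q)

  pathLength-++ : ∀ {i j k : Fin n} (p : Path i j) (q : Path j k) →
                  pathLength w (p ++ q) ≤⁺ pathLength w p +∞ pathLength w q
  pathLength-++ (edge i j)    q = ≤∞-refl
  pathLength-++ (_∷_ i {j} p) q =
    ≤∞-trans (+∞-mono-≤ ≤∞-refl (pathLength-++ p q)) (+∞-assoc-≤ (w i j) _ _)

  Inner< : ℕ → ∀ {i j : Fin n} → Path i j → Set
  Inner< K (edge i j)    = ⊤
  Inner< K (_∷_ i {j} p) = toℕ j ℕ.< K × Inner< K p

  inner<n : ∀ {i j : Fin n} (p : Path i j) → Inner< n p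
  inner<n (edge i j)    = tt
  inner<n (_∷_ i {j} p) = Fin.toℕ<n j , inner<n p

  -- Stated for a single row: IKJ finishes the rows one after another, so at a given moment they are
  -- bounded for different `K`.
  Bounded : Array n → Fin n → ℕ → Set
  Bounded d i K = ∀ j (p : Path i j) → Inner< K p → d i j ≤⁺ pathLength w p

  bounded-⊑ : ∀ {d e i K} → e ⊑ d → Bounded d i K → Bounded e i K
  bounded-⊑ e⊑d h j p inner = ≤∞-trans (e⊑d _ j) (h j p inner)

  ⊑w⇒bounded : ∀ {d i} → d ⊑ w → Bounded d i 0
  ⊑w⇒bounded d⊑w j (edge i j) _ = d⊑w i j

  -- The counterpart of `Bounded`: it keeps entries from falling too low. The two inequalities
  -- combine by antisymmetry at the end.
  Attained : Array n → Set
  Attained d = ∀ i j → ∃ λ (p : Path i j) → pathLength w p ≤⁺ d i j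

  relax-attained : ExcludedMiddle 0ℓ → ∀ i k j d → Attained d → Attained (relax i k j d)
  relax-attained em i k j d att =
    ≔-elim (λ a b x → ∃ λ (p : Path a b) → pathLength w p ≤⁺ x) d i j _ new att
    where
    new : ∃ λ (p : Path i j) → pathLength w p ≤⁺ d i j ⊓∞ (d i k +∞ d k j)
    new with ⊓∞-sel-≤ em (d i j) (d i k +∞ d k j)
    ... | inj₁ h = proj₁ (att i j) , ≤∞-trans (proj₂ (att i j)) h
    ... | inj₂ h =
      proj₁ (att i k) ++ proj₁ (att k j) ,
      ≤∞-trans (pathLength-++ (proj₁ (att i k)) (proj₁ (att k j)))
        (≤∞-trans (+∞-mono-≤ (proj₂ (att i k)) (proj₂ (att k j))) h)

  ikj-attained : ExcludedMiddle 0ℓ → ∀ d → Attained d → Attained (ikj d)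
  ikj-attained em =
    for-preserves Attained λ i → for-preserves Attained λ k → for-preserves Attained λ j →
      relax-attained em i k j

  module _ (nonneg : NoNegativeCycles w) where

    record Split (k : Fin n) {i j : Fin n} (p : Path i j) : Set where
      constructor mkSplit
      field
        prefix  : Path i k
        suffix  : Path k j
        prefix< : Inner< (toℕ k) prefix
        suffix< : Inner< (toℕ k) suffix
        shorter : pathLength w prefix +∞ pathLength w suffix ≤⁺ pathLength w p

    -- The recursion settles the last inner visit to `k` first and fixes `suffix` there; each
    -- earlier visit resets `prefix`. So `prefix` ends at the first visit and `suffix` starts at the
    -- last.
    split : ∀ k {i j} (p : Path i j) → Inner< (suc (toℕ k)) p → Inner< (toℕ k) p ⊎ Split k p
    split k (edge i j)    _             = inj₁ tt
    split k (_∷_ i {v} p) (v<1+k , p<)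
      with split k p p< | ℕ.m<1+n⇒m<n∨m≡n v<1+k
    ... | inj₁ p<k | inj₁ v<k = inj₁ (v<k , p<k)
    ... | inj₁ p<k | inj₂ v≡k with refl ← Fin.toℕ-injective v≡k =
      inj₂ (mkSplit (edge i v) p tt p<k ≤∞-refl)
    split k (_∷_ i {v} p) (v<1+k , p<)
        | inj₂ (mkSplit q r q< r< q+r≤p) | inj₁ v<k =
      inj₂ (mkSplit (i ∷ q) r (v<k , q<) r< (begin
        (w i v +∞ pathLength w q) +∞ pathLength w r ≲⟨ +∞-assoc-≥ (w i v) _ _ ⟩
        w i v +∞ (pathLength w q +∞ pathLength w r) ≲⟨ +∞-mono-≤ ≤∞-refl q+r≤p ⟩
        w i v +∞ pathLength w p                     ∎))
    -- Here q is a cycle at k and is dropped.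
    split k (_∷_ i {v} p) (v<1+k , p<)
        | inj₂ (mkSplit q r q< r< q+r≤p) | inj₂ v≡k with refl ← Fin.toℕ-injective v≡k =
      inj₂ (mkSplit (edge i v) r tt r< (+∞-mono-≤ ≤∞-refl (begin
        pathLength w r                    ≲⟨ +∞-identityˡ-≥ _ ⟩
        [ 0ℝ ] +∞ pathLength w r          ≲⟨ +∞-mono-≤ (nonneg v q) ≤∞-refl ⟩
        pathLength w q +∞ pathLength w r  ≲⟨ q+r≤p ⟩
        pathLength w p                    ∎)))

    -- The Floyd-Warshall step: the prefix of a split path is charged to row `i`, the suffix to row
    -- `k`.
    relaxAll-bounded : ∀ i k d → Bounded d i (toℕ k) → Bounded d k (toℕ k) →
                       Bounded (relaxAll i k d) i (suc (toℕ k))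
    relaxAll-bounded i k d bi bk j p p<1+k with split k p p<1+k
    ... | inj₁ p<k = ≤∞-trans (relaxAll-⊑ i k d i j) (bi j p p<k)
    ... | inj₂ (mkSplit q r q< r< q+r≤p) = begin
      relaxAll i k d i j                ≲⟨ relaxAll-≤ i k d j ⟩
      d i k +∞ d k j                    ≲⟨ +∞-mono-≤ (bi k q q<) (bk j r r<) ⟩
      pathLength w q +∞ pathLength w r  ≲⟨ q+r≤p ⟩
      pathLength w p                    ∎

    processRow-bounded : ∀ i d m → m ℕ.≤ n → d ⊑ w →
                         (∀ k → toℕ k ℕ.< m → Bounded d k (toℕ k)) →
                         Bounded (processRow i d) i m
    processRow-bounded i d m m≤n d⊑w bd =
      proj₂ (for-induction P step d (⊑-refl , λ { _ z≤n _ → ⊑w⇒bounded d⊑w })) m m≤n ℕ.≤-refl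
      where
      -- For middle indices from `m` on, no bound on row `k` is at hand; they merely lower entries.
      -- Hence `K` is capped by `m` and ranges over all values up to `k`.
      P : ℕ → Array n → Set
      P k e = e ⊑ d × ∀ K → K ℕ.≤ k → K ℕ.≤ m → Bounded e i K

      step : ∀ k e → P (toℕ k) e → P (suc (toℕ k)) (relaxAll i k e)
      step k e (e⊑d , be) = ⊑-trans (relaxAll-⊑ i k e) e⊑d , bounded
        where
        bounded : ∀ K → K ℕ.≤ suc (toℕ k) → K ℕ.≤ m → Bounded (relaxAll i k e) i K
        bounded K K≤1+k K≤m with ℕ.m≤n⇒m<n∨m≡n K≤1+k
        ... | inj₁ K<1+k = bounded-⊑ (relaxAll-⊑ i k e) (be K (ℕ.m<1+n⇒m≤n K<1+k) K≤m)
        -- `K≤m` now says `toℕ k < m`, so `bd` applies. Its bound on `d` carries over to `e` even if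
        -- `k` is `i`, the row being rewritten.
        ... | inj₂ refl  = relaxAll-bounded i k e
                (be (toℕ k) ℕ.≤-refl (ℕ.<⇒≤ K≤m)) (bounded-⊑ e⊑d (bd k K≤m))

    -- Covers both runs: `t i` is the bound that row `i` is to reach, and `ready` turns what is
    -- known when row `i` comes up into the hypothesis of `processRow-bounded`.
    ikj-bounded : ∀ (t : Fin n → ℕ) → (∀ i → t i ℕ.≤ n) → ∀ d → d ⊑ w →
                  (∀ i e → e ⊑ d → (∀ k → toℕ k ℕ.< toℕ i → Bounded e k (t k)) →
                     ∀ k → toℕ k ℕ.< t i → Bounded e k (toℕ k)) →
                  ∀ i → Bounded (ikj d) i (t i)
    ikj-bounded t t≤n d d⊑w ready i =
      proj₂ (for-induction P step d (⊑-refl , λ _ ())) i (Fin.toℕ<n i)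
      where
      P : ℕ → Array n → Set
      P m e = e ⊑ d × ∀ k → toℕ k ℕ.< m → Bounded e k (t k)

      step : ∀ i e → P (toℕ i) e → P (suc (toℕ i)) (processRow i e)
      step i e (e⊑d , be) = ⊑-trans (processRow-⊑ i e) e⊑d , bounded
        where
        bounded : ∀ k → toℕ k ℕ.< suc (toℕ i) → Bounded (processRow i e) k (t k)
        bounded k k<1+i with ℕ.m<1+n⇒m<n∨m≡n k<1+i
        ... | inj₁ k<i = bounded-⊑ (processRow-⊑ i e) (be k k<i)
        ... | inj₂ k≡i with refl ← Fin.toℕ-injective k≡i =
          processRow-bounded i e (t i) (t≤n i) (⊑-trans e⊑d d⊑w) (ready i e e⊑d be)

    ikj-bounded-below : ∀ i → Bounded (ikj w) i (toℕ i)
    ikj-bounded-below =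
      -- With `t = toℕ`, the rows above `i` have reached exactly what row `i` asks of them, so
      -- `ready` just returns its argument.
      ikj-bounded toℕ (λ i → ℕ.<⇒≤ (Fin.toℕ<n i)) w ⊑-refl (λ _ _ _ be → be)

    ikj²-≤ : ∀ {i j} (p : Path i j) → ikj (ikj w) i j ≤⁺ pathLength w p
    ikj²-≤ {i} {j} p =
      -- With `t` constantly `n`, the prerequisites of every row come from the first run and survive
      -- because entries only decrease.
      ikj-bounded (const n) (λ _ → ℕ.≤-refl) (ikj w) (ikj-⊑ w)
        (λ _ _ e⊑d _ k _ → bounded-⊑ e⊑d (ikj-bounded-below k))
        i j p (inner<n p)

-- The path witnessing attainment is itself shortest: its length is at most the entry, which is at
-- most the length of every path. Initially, single edges attain `w`.
ikj²-solves : ExcludedMiddle 0ℓ → ∀ I → SolvesAPSP I (ikj (ikj (Instance.w I)))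
ikj²-solves em I i j =
  let p , p≤d = ikj-attained w em (ikj w) (ikj-attained w em w λ i j → edge i j , ≤∞-refl) i j
  in p ,
     (λ q → ≤∞-trans p≤d (ikj²-≤ w noNegativeCycles q)) ,
     ≤⁺-antisym (λ {x} {y} → ≤ℝ-antisym {x} {y}) (ikj²-≤ w noNegativeCycles p) p≤d
  where open Instance I

-- An instance on which one run fails.

zeroEdge : Fin 4 → Fin 4 → Bool
zeroEdge 0F 2F = true
zeroEdge 2F 1F = true
zeroEdge 1F 3F = true
zeroEdge i  j  = does (i Fin.≟ j)

-- Lengths factor through `Bool`, so nonnegativity takes two cases instead of sixteen.
0-or-∞ : Bool → ℝ∞
0-or-∞ b = if b then [ 0ℝ ] else ⊤⁺

0-or-∞-nonneg : ∀ b → [ 0ℝ ] ≤⁺ 0-or-∞ b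
0-or-∞-nonneg true  = ≤∞-refl
0-or-∞-nonneg false = _ ≤⊤⁺

nonneg⇒pathLength-nonneg : ∀ {n} {w : Array n} → (∀ i j → [ 0ℝ ] ≤⁺ w i j) →
                           ∀ {i j} (p : Path i j) → [ 0ℝ ] ≤⁺ pathLength w p
nonneg⇒pathLength-nonneg h (edge i j)    = h i j
nonneg⇒pathLength-nonneg h (_∷_ i {j} p) =
  ≤∞-trans (nonneg⇒pathLength-nonneg h p)
    (≤∞-trans (+∞-identityˡ-≥ _) (+∞-mono-≤ (h i j) ≤∞-refl))

counterexample : Instance
counterexample = record
  { n                = 4
  ; w                = λ i j → 0-or-∞ (zeroEdge i j)
  ; noNegativeCycles = λ _ →
      nonneg⇒pathLength-nonneg (λ i j → 0-or-∞-nonneg (zeroEdge i j))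
  }

-- In row 0, entry (0,1) is still `⊤⁺` at `k = 1`. It becomes finite at `k = 2`, but then entry
-- (2,3) is `⊤⁺`, as row 2 has not been treated. Only constructors of `ℝ∞` decide this, so
-- evaluation suffices.
ikj-misses-0→2→1→3 : ikj (Instance.w counterexample) 0F 3F ≡ ⊤⁺
ikj-misses-0→2→1→3 = refl

-- Since `≈⁺` relates `⊤⁺` only to itself, the shortest `q` would have length `⊤⁺`, yet it may not
-- exceed the finite length of `p`.
∞-not-distance : ∀ {n} {w : Array n} {i j} {x} (p : Path i j) → pathLength w p ≡ [ x ] →
                 ¬ IsShortestPathDistance w i j ⊤⁺
∞-not-distance {w = w} p p≡x (q , q-shortest , ∞≈q) with pathLength w q | q-shortest p | ∞≈q
... | ⊤⁺ | q≤p | _ with () ← subst (⊤⁺ ≤⁺_) p≡x q≤p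

ikj-fails : ¬ SolvesAPSP counterexample (ikj (Instance.w counterexample))
ikj-fails solves =
  ∞-not-distance (0F ∷ 2F ∷ edge 1F 3F) refl
    (subst (IsShortestPathDistance (Instance.w counterexample) 0F 3F) ikj-misses-0→2→1→3
      (solves 0F 3F))

theorem2 : (ExcludedMiddle 0ℓ →
    ∀ (I : Instance) → SolvesAPSP I (ikj (ikj (Instance.w I))))
    × (∃ λ (I : Instance) → ¬ SolvesAPSP I (ikj (Instance.w I)))
theorem2 = ikj²-solves , counterexample , ikj-fails
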